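{- Let $x,y$ be independent indeterminates and let $i_1,i_2,i_3,j_1,j_2,j_3\in\mathbb Z_{\ge0}$ satisfy the balance condition $i_1+j_2+j_3=i_2+i_3+j_1$. Consider the Yang--Baxter equation \[ \sum_{k_1,k_2,k_3\ge0}\mathbb R_{x,y}(i_2,i_1;k_2,k_1)\,W_x(k_3,k_2;j_3,j_2)\,W^*_y(i_3,k_1;k_3,j_1)=\sum_{k_1',k_2',k_3'\ge0}W_x(i_3,i_2;k_3',k_2')\,W^*_y(k_3',i_1;j_3,k_1')\,\mathbb R_{x,y}(k_2',k_1';j_2,j_1), \] in which arrow conservation leaves one free internal coordinate on each side: \[ (k_1,k_2,k_3)=(k_1,\;i_2+k_1-i_1,\;i_3+j_1-k_1),\qquad (k_1',k_2',k_3')=(k_1',\;k_1'+j_2-j_1,\;j_3+i_1-k_1'). \] Then: (1) The summands on the left- and right-hand sides are, respectively, \[ x^{j_2}y^{j_1}(xy)^{\min(k_1,k_2)}\qquad\text{and}\qquad x^{k_2'}y^{k_1'}(xy)^{\min(j_1,j_2)}, \] and they are nonzero exactly for $k_1$, respectively $k_1'$, in the integer intervals \[ \max(0,i_1-i_2)\le k_1\le\min(i_3,\,i_3+j_1-j_2),\qquad \max(0,j_1-j_2)\le k_1'\le\min(j_3,\,j_3+i_1-i_2) \] (that is, inside these intervals the summands are the displayed monomials, and outside they vanish). The two intervals contain the same number of integer points. (2) The map \[ k_1'=j_1-\min(j_1,j_2)+\min(k_1,k_2)=k_1+\max(0,j_1-j_2)-\max(0,i_1-i_2) \] is a weight-preserving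 bijection from the first interval to the second: the left summand at $k_1$ equals the right summand at $k_1'$. (3) It is the only weight-preserving bijection between the two intervals: within each of the two lists of summands the monomials are pairwise distinct.
   Context: All arguments of the weights are nonnegative integers. The weights are \[ W_x(i_1,j_1;i_2,j_2)=\mathbf 1_{i_1+j_1=i_2+j_2}\,\mathbf 1_{i_1\ge j_2}\,x^{j_2},\qquad W^*_y(i_1,j_1;i_2,j_2)=\mathbf 1_{i_2+j_1=i_1+j_2}\,\mathbf 1_{i_2\ge j_2}\,y^{j_2}, \] \[ \mathbb R_{x,y}(i_1,j_1;i_2,j_2)=\mathbf 1_{i_1+j_2=j_1+i_2}\,(xy)^{\min(i_2,j_2)}, \] where $\mathbf 1$ denotes the indicator (1 if the condition holds, 0 otherwise). A weight is regarded as $0$ if one of its arguments would be negative. -}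

module Defs where

open import Algebra.Bundles.Raw using (RawSemiring)
open import Data.Bool.Base using (if_then_else_; _∧_)
open import Data.Integer.Base as ℤ
  using (ℤ; +_; 0ℤ; 1ℤ; ∣_∣; _+_; _-_; _⊔_; _⊓_)
open import Data.List.Base using (List; []; _∷_; _++_; cartesianProductWith)
open import Data.Nat.Base as ℕ using (ℕ)
import Data.Nat.Properties as ℕ
open import Data.Product.Base using (Σ-syntax; _×_; _,_; proj₁)
open import Level using (0ℓ)
open import Relation.Binary.PropositionalEquality using (_≡_)
open import Relation.Nullary.Decidable.Core using (Dec; does)

-- The polynomial ring ℤ[x,y].  A polynomial is a finite formal sum of terms,
-- (c , m , n) standing for c xᵐ yⁿ; repeated exponents and zero coefficients
-- are allowed, and equality is equality of all collected coefficients.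

Term : Set
Term = ℤ × ℕ × ℕ

Poly : Set
Poly = List Term

coeff : Poly → ℕ → ℕ → ℤ
coeff []                a b = 0ℤ
coeff ((c , m , n) ∷ p) a b =
  (if (m ℕ.≡ᵇ a) ∧ (n ℕ.≡ᵇ b) then c else 0ℤ) ℤ.+ coeff p a b

infix 4 _≈ₚ_
record _≈ₚ_ (p q : Poly) : Set where
  constructor mk≈
  field coeff-≡ : ∀ a b → coeff p a b ≡ coeff q a b

_·_ : Term → Term → Term
(c , m , n) · (c′ , m′ , n′) = c ℤ.* c′ , m ℕ.+ m′ , n ℕ.+ n′

ℤ[x,y] : RawSemiring 0ℓ 0ℓ
ℤ[x,y] = record
  { Carrier = Poly
  ; _≈_     = _≈ₚ_
  ; _+_     = _++_
  ; _*_     = cartesianProductWith _·_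
  ; 0#      = []
  ; 1#      = (1ℤ , 0 , 0) ∷ []
  }

open RawSemiring ℤ[x,y] public using (_≈_; _≉_; _*_; 0#; 1#)
open import Algebra.Definitions.RawSemiring ℤ[x,y] public using (_^_)

x y : Poly
x = (1ℤ , 1 , 0) ∷ []
y = (1ℤ , 0 , 1) ∷ []

𝟙 : ∀ {P : Set} → Dec P → Poly
𝟙 P? = if does P? then 1# else 0#

Weight : Set → Set
Weight A = (i₁ j₁ i₂ j₂ : A) → Poly

W : Poly → Weight ℕ
W u i₁ j₁ i₂ j₂ = 𝟙 (i₁ ℕ.+ j₁ ℕ.≟ i₂ ℕ.+ j₂) * 𝟙 (j₂ ℕ.≤? i₁) * u ^ j₂

W* : Poly → Weight ℕ
W* v i₁ j₁ i₂ j₂ = 𝟙 (i₂ ℕ.+ j₁ ℕ.≟ i₁ ℕ.+ j₂) * 𝟙 (j₂ ℕ.≤? i₂) * v ^ j₂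

R : Poly → Poly → Weight ℕ
R u v i₁ j₁ i₂ j₂ = 𝟙 (i₁ ℕ.+ j₂ ℕ.≟ j₁ ℕ.+ i₂) * (u * v) ^ (i₂ ℕ.⊓ j₂)

extend : Weight ℕ → Weight ℤ
extend w (+ i₁) (+ j₁) (+ i₂) (+ j₂) = w i₁ j₁ i₂ j₂
extend w _      _      _      _      = 0#

infix 4 _∈[_,_]
_∈[_,_] : ℤ → ℤ → ℤ → Set
k ∈[ a , b ] = a ℤ.≤ k × k ℤ.≤ b

module YangBaxter (i₁ i₂ i₃ j₁ j₂ j₃ : ℕ) where

  -- The general terms of the two triple sums over k ≥ 0 in the Yang–Baxter
  -- equation; for a negative index they vanish through extend.

  left : (k₁ k₂ k₃ : ℤ) → Poly
  left k₁ k₂ k₃ = extend (R x y) (+ i₂) (+ i₁) k₂ k₁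
                * extend (W x) k₃ k₂ (+ j₃) (+ j₂)
                * extend (W* y) (+ i₃) k₁ k₃ (+ j₁)

  right : (k₁′ k₂′ k₃′ : ℤ) → Poly
  right k₁′ k₂′ k₃′ = extend (W x) (+ i₃) (+ i₂) k₃′ k₂′
                    * extend (W* y) k₃′ (+ i₁) (+ j₃) k₁′
                    * extend (R x y) k₂′ k₁′ (+ j₂) (+ j₁)

  -- Their values on the line left free by arrow conservation.

  k₂ k₃ k₂′ k₃′ : ℤ → ℤ
  k₂  k₁  = + i₂ + k₁ - + i₁
  k₃  k₁  = + i₃ + + j₁ - k₁
  k₂′ k₁′ = k₁′ + + j₂ - + j₁
  k₃′ k₁′ = + j₃ + + i₁ - k₁′

  leftSummand rightSummand : ℤ → Poly
  leftSummand  k₁  = left k₁ (k₂ k₁) (k₃ k₁)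
  rightSummand k₁′ = right k₁′ (k₂′ k₁′) (k₃′ k₁′)

  -- The exponents below are nonnegative on the respective intervals, the only
  -- place where these monomials are used, so ∣_∣ is just the passage to ℕ.

  leftMonomial rightMonomial : ℤ → Poly
  leftMonomial  k₁  = x ^ j₂ * y ^ j₁ * (x * y) ^ ∣ k₁ ⊓ k₂ k₁ ∣
  rightMonomial k₁′ = x ^ ∣ k₂′ k₁′ ∣ * y ^ ∣ k₁′ ∣ * (x * y) ^ (j₁ ℕ.⊓ j₂)

  infix 4 _∈L _∈R
  _∈L _∈R : ℤ → Set
  k₁  ∈L = k₁  ∈[ 0ℤ ⊔ (+ i₁ - + i₂) , + i₃ ⊓ (+ i₃ + + j₁ - + j₂) ]
  k₁′ ∈R = k₁′ ∈[ 0ℤ ⊔ (+ j₁ - + j₂) , + j₃ ⊓ (+ j₃ + + i₁ - + i₂) ]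

  LeftInterval RightInterval : Set
  LeftInterval  = Σ[ k₁ ∈ ℤ ] k₁ ∈L
  RightInterval = Σ[ k₁′ ∈ ℤ ] k₁′ ∈R

  φ : ℤ → ℤ
  φ k₁ = + j₁ - (+ j₁ ⊓ + j₂) + (k₁ ⊓ k₂ k₁)

  φ-alt : ℤ → ℤ
  φ-alt k₁ = k₁ + (0ℤ ⊔ (+ j₁ - + j₂)) - (0ℤ ⊔ (+ i₁ - + i₂))

  WeightPreserving : (LeftInterval → RightInterval) → Set
  WeightPreserving f = ∀ k → leftSummand (proj₁ k) ≈ rightSummand (proj₁ (f k))

{-# OPTIONS --safe #-}

-- Every nonzero value of a weight is a monomial, so after substituting arrow
-- conservation both kinds of summands are zero or monomials, and nonvanishing
-- means that the indices are nonnegative and the two inequalities in W and W*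
-- hold.  Since p ⊓ (p + t) = p + t − (0 ⊔ t), both intervals have length
-- i₃ + (j₁ − j₂) − (0 ⊔ (j₁ − j₂)) − (0 ⊔ (i₁ − i₂)), the balance condition
-- being i₃ + (j₁ − j₂) = j₃ + (i₁ − i₂); and φ is the translation that matches
-- their lower ends.  The exponent of y determines the index on either side,
-- which gives uniqueness.

module Submission where

open import Defs
open import Data.Bool.Base using (true; false; _∧_; T)
open import Data.Bool.Properties using (T-∧)
open import Data.Empty using (⊥-elim)
open import Data.Fin.Base using (Fin; toℕ; fromℕ<)
open import Data.Fin.Properties using (fromℕ<-toℕ; toℕ-fromℕ<; toℕ≤pred[n])
open import Data.Integer.Base as ℤ using (ℤ; +_; -[1+_]; 0ℤ; 1ℤ; ∣_∣)
import Data.Integer.Properties as ℤ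
open import Data.Integer.Tactic.RingSolver using (solve-∀)
open import Data.List.Base using ([]; _∷_)
open import Data.List.Properties using (cartesianProductWith-zeroʳ)
open import Data.Nat.Base as ℕ using (ℕ; zero; suc; z≤n; s≤s)
import Data.Nat.Properties as ℕ
open import Data.Product.Base using (Σ-syntax; ∃-syntax; _×_; _,_; proj₁; proj₂)
open import Data.Sum.Base using (_⊎_; inj₁; inj₂)
open import Data.Unit.Base using (tt)
open import Function.Base using (_∘_)
open import Function.Bundles using (_⇔_; _⤖_; _↔_; mk⇔; mk↔ₛ′; module Bijection; module Equivalence)
open import Function.Construct.Composition using (_↔-∘_)
open import Function.Properties.Inverse using (↔⇒⤖; ↔-sym)
open import Relation.Binary.PropositionalEquality
  using (_≡_; _≢_; refl; sym; trans; cong; cong₂; subst; subst₂)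
open import Relation.Nullary.Decidable.Core using (Dec; yes; no)
open import Relation.Nullary.Negation.Core using (¬_; contradiction)

-- Monomials

≈-refl : ∀ {p} → p ≈ p
≈-refl = mk≈ λ _ _ → refl

≈-reflexive : ∀ {p q} → p ≡ q → p ≈ q
≈-reflexive refl = ≈-refl

≈-sym : ∀ {p q} → p ≈ q → q ≈ p
≈-sym (mk≈ e) = mk≈ λ a b → sym (e a b)

≈-trans : ∀ {p q r} → p ≈ q → q ≈ r → p ≈ r
≈-trans (mk≈ e) (mk≈ f) = mk≈ λ a b → trans (e a b) (f a b)

-- The normal form of every nonzero weight and summand. Products of such one-term lists reduce to
-- one-term lists, so values can be stated with `≡`.
mono : ℕ → ℕ → Poly
mono m n = (1ℤ , m , n) ∷ []

coeff-mono : ∀ m n → coeff (mono m n) m n ≡ 1ℤ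
-- The test is abstracted together with a proof of its truth, which leaves no `false` case.
coeff-mono m n with (m ℕ.≡ᵇ m) ∧ (n ℕ.≡ᵇ n)
                  | Equivalence.from (T-∧ {m ℕ.≡ᵇ m} {n ℕ.≡ᵇ n}) (ℕ.≡⇒≡ᵇ m m refl , ℕ.≡⇒≡ᵇ n n refl)
... | true | _ = refl

coeff-mono⇒≡ : ∀ m n a b → coeff (mono m n) a b ≡ 1ℤ → m ≡ a × n ≡ b
coeff-mono⇒≡ m n a b with (m ℕ.≡ᵇ a) ∧ (n ℕ.≡ᵇ b) in eq
... | true  = λ _ → let m≡a , n≡b = Equivalence.to T-∧ (subst T (sym eq) tt)
                    in ℕ.≡ᵇ⇒≡ m a m≡a , ℕ.≡ᵇ⇒≡ n b n≡b
... | false = λ ()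

-- At the exponents of the second monomial both coefficients are 1, and a monomial has coefficient 1
-- only at its own exponents.
mono-injective : ∀ {m n m′ n′} → mono m n ≈ mono m′ n′ → m ≡ m′ × n ≡ n′
mono-injective {m} {n} {m′} {n′} (mk≈ e) =
  coeff-mono⇒≡ m n m′ n′ (trans (e m′ n′) (coeff-mono m′ n′))

mono≉0 : ∀ m n → mono m n ≉ 0#
mono≉0 m n (mk≈ e) with () ← trans (sym (coeff-mono m n)) (e m n)

x^n≡mono : ∀ n → x ^ n ≡ mono n 0
x^n≡mono zero    = refl
x^n≡mono (suc n) = cong (x *_) (x^n≡mono n)

y^n≡mono : ∀ n → y ^ n ≡ mono 0 n
y^n≡mono zero    = refl
y^n≡mono (suc n) = cong (y *_) (y^n≡mono n)

[xy]^n≡mono : ∀ n → (x * y) ^ n ≡ mono n n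
[xy]^n≡mono zero    = refl
[xy]^n≡mono (suc n) = cong (x * y *_) ([xy]^n≡mono n)

-- A true indicator is `1#`, that is `mono 0 0`, so this one computation evaluates `W` and `W*` as
-- well as the summands.
mono-* : ∀ {p q r a b c d e f} → p ≡ mono a b → q ≡ mono c d → r ≡ mono e f →
         p * q * r ≡ mono (a ℕ.+ c ℕ.+ e) (b ℕ.+ d ℕ.+ f)
mono-* refl refl refl = refl

-- Vanishing is handled as p ≡ 0#, which is visibly decidable and implies p ≈ 0#.

≉0⇒≢0 : ∀ {p} → p ≉ 0# → p ≢ 0#
≉0⇒≢0 p≉0 = p≉0 ∘ ≈-reflexive

¬≢0⇒≈0 : ∀ {p} → ¬ (p ≢ 0#) → p ≈ 0#
¬≢0⇒≈0 {[]}    _ = ≈-refl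
¬≢0⇒≈0 {_ ∷ _} h = contradiction (λ ()) h

*-≢0ˡ : ∀ {p} q → p * q ≢ 0# → p ≢ 0#
*-≢0ˡ q pq≢0 = pq≢0 ∘ cong (_* q)

*-≢0ʳ : ∀ p {q} → p * q ≢ 0# → q ≢ 0#
-- Multiplication recurses on its left factor, so `p * []` does not reduce by itself.
*-≢0ʳ p pq≢0 q≡0 = pq≢0 (trans (cong (p *_) q≡0) (cartesianProductWith-zeroʳ _·_ p))

-- Indicators and weights: nonvanishing and values

𝟙≢0⇒holds : ∀ {P : Set} (P? : Dec P) → 𝟙 P? ≢ 0# → P
𝟙≢0⇒holds (yes p) _   = p
𝟙≢0⇒holds (no _)  1≢0 = contradiction refl 1≢0

𝟙-holds : ∀ {P : Set} (P? : Dec P) → P → 𝟙 P? ≡ 1#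
𝟙-holds (yes _) _ = refl
𝟙-holds (no ¬p) p = contradiction p ¬p

-- Matching on `lifted` turns all four integer indices into natural numbers at once; negative
-- indices have no constructor.
data Lifted (w : Weight ℕ) : (i₁ j₁ i₂ j₂ : ℤ) → Set where
  lifted : ∀ {i₁ j₁ i₂ j₂} → w i₁ j₁ i₂ j₂ ≢ 0# → Lifted w (+ i₁) (+ j₁) (+ i₂) (+ j₂)

extend≢0⇒lifted : ∀ w i₁ j₁ i₂ j₂ → extend w i₁ j₁ i₂ j₂ ≢ 0# → Lifted w i₁ j₁ i₂ j₂
extend≢0⇒lifted w (+ _)    (+ _)    (+ _)    (+ _)    w≢0 = lifted w≢0
extend≢0⇒lifted w (+ _)    (+ _)    (+ _)    -[1+ _ ] 0≢0 = contradiction refl 0≢0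
extend≢0⇒lifted w (+ _)    (+ _)    -[1+ _ ] _        0≢0 = contradiction refl 0≢0
extend≢0⇒lifted w (+ _)    -[1+ _ ] _        _        0≢0 = contradiction refl 0≢0
extend≢0⇒lifted w -[1+ _ ] _        _        _        0≢0 = contradiction refl 0≢0

module _ {i₁ j₁ i₂ j₂ : ℕ} where
  open import Data.Nat.Base using (_+_; _⊓_; _≤_)

  W≢0 : ∀ u → W u i₁ j₁ i₂ j₂ ≢ 0# → i₁ + j₁ ≡ i₂ + j₂ × j₂ ≤ i₁
  W≢0 u W≢0 = 𝟙≢0⇒holds (i₁ + j₁ ℕ.≟ i₂ + j₂) (*-≢0ˡ _ 𝟙𝟙≢0)
            , 𝟙≢0⇒holds (j₂ ℕ.≤? i₁) (*-≢0ʳ (𝟙 (i₁ + j₁ ℕ.≟ i₂ + j₂)) 𝟙𝟙≢0)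
    where 𝟙𝟙≢0 = *-≢0ˡ (u ^ j₂) W≢0

  W*≢0 : ∀ v → W* v i₁ j₁ i₂ j₂ ≢ 0# → i₂ + j₁ ≡ i₁ + j₂ × j₂ ≤ i₂
  W*≢0 v W*≢0 = 𝟙≢0⇒holds (i₂ + j₁ ℕ.≟ i₁ + j₂) (*-≢0ˡ _ 𝟙𝟙≢0)
              , 𝟙≢0⇒holds (j₂ ℕ.≤? i₂) (*-≢0ʳ (𝟙 (i₂ + j₁ ℕ.≟ i₁ + j₂)) 𝟙𝟙≢0)
    where 𝟙𝟙≢0 = *-≢0ˡ (v ^ j₂) W*≢0

  R≢0 : ∀ u v → R u v i₁ j₁ i₂ j₂ ≢ 0# → i₁ + j₂ ≡ j₁ + i₂
  R≢0 u v R≢0 = 𝟙≢0⇒holds (i₁ + j₂ ℕ.≟ j₁ + i₂) (*-≢0ˡ ((u * v) ^ (i₂ ⊓ j₂)) R≢0)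

  W-value : i₁ + j₁ ≡ i₂ + j₂ → j₂ ≤ i₁ → W x i₁ j₁ i₂ j₂ ≡ mono j₂ 0
  W-value e j₂≤i₁ = mono-* (𝟙-holds (i₁ + j₁ ℕ.≟ i₂ + j₂) e) (𝟙-holds (j₂ ℕ.≤? i₁) j₂≤i₁) (x^n≡mono j₂)

  W*-value : i₂ + j₁ ≡ i₁ + j₂ → j₂ ≤ i₂ → W* y i₁ j₁ i₂ j₂ ≡ mono 0 j₂
  W*-value e j₂≤i₂ = mono-* (𝟙-holds (i₂ + j₁ ℕ.≟ i₁ + j₂) e) (𝟙-holds (j₂ ℕ.≤? i₂) j₂≤i₂) (y^n≡mono j₂)

  R-value : i₁ + j₂ ≡ j₁ + i₂ → R x y i₁ j₁ i₂ j₂ ≡ mono (i₂ ⊓ j₂) (i₂ ⊓ j₂)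
  R-value e = cong₂ _*_ (𝟙-holds (i₁ + j₂ ℕ.≟ j₁ + i₂) e) ([xy]^n≡mono (i₂ ⊓ j₂))

-- Integer intervals

module _ where
  open import Data.Integer.Base using (_+_; _-_; _≤_; _⊓_; _⊔_; +≤+)

  p+q≡r⇒p≡r-q : ∀ {p q r} → p + q ≡ r → p ≡ r - q
  p+q≡r⇒p≡r-q {p} {q} refl = cancel p q
    where cancel : ∀ p q → p ≡ p + q - q
          cancel = solve-∀

  -- The inequalities below are rearrangements of one another with the same difference of sides,
  -- which leaves a ring identity to check.
  ≤-by-difference : ∀ {a b c d} → b - a ≡ d - c → a ≤ b → c ≤ d
  ≤-by-difference e a≤b = ℤ.0≤i-j⇒j≤i (subst (0ℤ ≤_) e (ℤ.i≤j⇒0≤j-i a≤b))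

  -- Adding `p` commutes with minima, so the claim reduces to `0 ⊓ t = t - (0 ⊔ t)`, which the sign
  -- of `t` decides.
  ⊓-+ : ∀ p t → p ⊓ (p + t) ≡ p + t - (0ℤ ⊔ t)
  ⊓-+ p t = trans (cong (_⊓ (p + t)) (sym (ℤ.+-identityʳ p)))
           (trans (sym (ℤ.mono-≤-distrib-⊓ (ℤ.+-monoʳ-≤ p) 0ℤ t)) (cases (ℤ.≤-total 0ℤ t)))
    where
    cancel : ∀ p t → p + 0ℤ ≡ p + t - t
    cancel = solve-∀
    cancel-0 : ∀ p t → p + t ≡ p + t - 0ℤ
    cancel-0 = solve-∀
    cases : 0ℤ ≤ t ⊎ t ≤ 0ℤ → p + (0ℤ ⊓ t) ≡ p + t - (0ℤ ⊔ t)
    cases (inj₁ 0≤t) rewrite ℤ.i≤j⇒i⊓j≡i 0≤t | ℤ.i≤j⇒i⊔j≡j 0≤t = cancel p t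
    cases (inj₂ t≤0) rewrite ℤ.i≥j⇒i⊓j≡j t≤0 | ℤ.i≥j⇒i⊔j≡i t≤0 = cancel-0 p t

  Interval : ℤ → ℤ → Set
  Interval a b = Σ[ k ∈ ℤ ] k ∈[ a , b ]

  index-injective : ∀ {a b} {k l : Interval a b} → proj₁ k ≡ proj₁ l → k ≡ l
  index-injective {k = k , p , q} {l = .k , p′ , q′} refl =
    cong (k ,_) (cong₂ _,_ (ℤ.≤-irrelevant p p′) (ℤ.≤-irrelevant q q′))

  translate-∈ : ∀ {a b a′ b′} → b - a ≡ b′ - a′ → ∀ {k} → k ∈[ a , b ] → k + a′ - a ∈[ a′ , b′ ]
  translate-∈ {a} {b} {a′} {b′} e {k} (a≤k , k≤b) =
      ≤-by-difference (lower k a a′) a≤k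
    , ≤-by-difference (trans (upper k a b) (trans (cong (_- (k - a)) e) (upper′ k a a′ b′))) k≤b
    where
    lower : ∀ k a a′ → k - a ≡ (k + a′ - a) - a′
    lower = solve-∀
    upper : ∀ k a b → b - k ≡ (b - a) - (k - a)
    upper = solve-∀
    upper′ : ∀ k a a′ b′ → (b′ - a′) - (k - a) ≡ b′ - (k + a′ - a)
    upper′ = solve-∀

  translate : ∀ {a b a′ b′} → b - a ≡ b′ - a′ → Interval a b ↔ Interval a′ b′
  translate {a} {b} {a′} {b′} e = mk↔ₛ′
    (λ (k , k∈) → k + a′ - a , translate-∈ e k∈)
    (λ (k , k∈) → k + a - a′ , translate-∈ (sym e) k∈)
    (λ (k , _) → index-injective (cancel k a′ a))
    (λ (k , _) → index-injective (cancel k a a′))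
    where
    cancel : ∀ k a a′ → (k + a′ - a) + a - a′ ≡ k
    cancel = solve-∀

  Interval-0↔Fin : ∀ b → ∃[ n ] (Interval 0ℤ b ↔ Fin n)
  Interval-0↔Fin -[1+ _ ] = 0 , mk↔ₛ′ (λ k → ⊥-elim (empty k)) (λ ()) (λ ()) (λ k → ⊥-elim (empty k))
    where
    empty : ∀ {m} → ¬ Interval 0ℤ -[1+ m ]
    empty (_ , +≤+ _ , ())
  -- Both ends belong to the interval, hence `suc m` points.
  Interval-0↔Fin (+ m) = suc m , mk↔ₛ′ to from to∘from from∘to
    where
    to : Interval 0ℤ (+ m) → Fin (suc m)
    to (+ k , _ , +≤+ k≤m) = fromℕ< (s≤s k≤m)
    from : Fin (suc m) → Interval 0ℤ (+ m)
    from i = + toℕ i , +≤+ z≤n , +≤+ (toℕ≤pred[n] i)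
    to∘from : ∀ i → to (from i) ≡ i
    to∘from i = fromℕ<-toℕ i (s≤s (toℕ≤pred[n] i))
    from∘to : ∀ k → from (to k) ≡ k
    from∘to (+ k , _ , +≤+ k≤m) = index-injective (cong +_ (toℕ-fromℕ< (s≤s k≤m)))

  -- Translation moves the lower end to `0ℤ`; an empty interval becomes one with negative upper end.
  Interval↔Fin : ∀ a b → ∃[ n ] (Interval a b ↔ Fin n)
  Interval↔Fin a b = let n , g = Interval-0↔Fin (b - a)
                     in n , g ↔-∘ translate (sym (ℤ.+-identityʳ (b - a)))

-- Terms of the Yang-Baxter equation under the balance condition

module Summands (i₁ i₂ i₃ j₁ j₂ j₃ : ℕ) (balance : i₁ ℕ.+ j₂ ℕ.+ j₃ ≡ i₂ ℕ.+ i₃ ℕ.+ j₁) where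
  open YangBaxter i₁ i₂ i₃ j₁ j₂ j₃
  open import Data.Integer.Base using (_+_; _-_; _≤_; _⊓_; _⊔_; +≤+)

  -- The balance condition, rearranged to say that the second upper bounds of the two intervals
  -- coincide.
  balance-shift : + i₃ + (+ j₁ - + j₂) ≡ + j₃ + (+ i₁ - + i₂)
  balance-shift = trans (expand (+ i₂) (+ i₃) (+ j₁) (+ j₂))
                 (trans (cong (λ s → s - (+ i₂ + + j₂)) (cong +_ (sym balance)))
                        (collect (+ i₁) (+ i₂) (+ j₂) (+ j₃)))
    where
    expand : ∀ i₂ i₃ j₁ j₂ → i₃ + (j₁ - j₂) ≡ (i₂ + i₃ + j₁) - (i₂ + j₂)
    expand = solve-∀
    collect : ∀ i₁ i₂ j₂ j₃ → (i₁ + j₂ + j₃) - (i₂ + j₂) ≡ j₃ + (i₁ - i₂)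
    collect = solve-∀

  -- Support and value of the left-hand terms

  record LeftSupport (k₁ k₂ k₃ : ℤ) : Set where
    constructor leftSupport
    field
      0≤k₁    : 0ℤ ≤ k₁
      0≤k₂    : 0ℤ ≤ k₂
      0≤k₃    : 0ℤ ≤ k₃
      R-cons  : + i₂ + k₁ ≡ + i₁ + k₂
      W-cons  : k₃ + k₂ ≡ + j₃ + + j₂
      j₂≤k₃   : + j₂ ≤ k₃
      W*-cons : k₃ + k₁ ≡ + i₃ + + j₁
      j₁≤k₃   : + j₁ ≤ k₃

  left≢0⇒support : ∀ a b c → left a b c ≢ 0# → LeftSupport a b c
  left≢0⇒support a b c left≢0 = support
    (extend≢0⇒lifted (R x y) (+ i₂) (+ i₁) b a (*-≢0ˡ Wₑ RW≢0))
    (extend≢0⇒lifted (W x) c b (+ j₃) (+ j₂) (*-≢0ʳ Rₑ RW≢0))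
    (extend≢0⇒lifted (W* y) (+ i₃) a c (+ j₁) (*-≢0ʳ (Rₑ * Wₑ) left≢0))
    where
    Rₑ = extend (R x y) (+ i₂) (+ i₁) b a
    Wₑ = extend (W x) c b (+ j₃) (+ j₂)
    RW≢0 = *-≢0ˡ (extend (W* y) (+ i₃) a c (+ j₁)) left≢0
    -- The indices are bound afresh so that matching on `lifted` can refine them.
    support : ∀ {a b c} → Lifted (R x y) (+ i₂) (+ i₁) b a → Lifted (W x) c b (+ j₃) (+ j₂) →
              Lifted (W* y) (+ i₃) a c (+ j₁) → LeftSupport a b c
    support (lifted {i₂ = b} {j₂ = a} r) (lifted w) (lifted w*) =
      let W-cons  , j₂≤k₃ = W≢0 x w
          W*-cons , j₁≤k₃ = W*≢0 y w*
      in leftSupport (+≤+ z≤n) (+≤+ z≤n) (+≤+ z≤n) (cong +_ (R≢0 {i₂} {i₁} {b} {a} x y r))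
           (cong +_ W-cons) (+≤+ j₂≤k₃) (cong +_ W*-cons) (+≤+ j₁≤k₃)

  left-value : ∀ {a b c} → LeftSupport a b c →
               left a b c ≡ mono (j₂ ℕ.+ ∣ a ⊓ b ∣) (j₁ ℕ.+ ∣ a ⊓ b ∣)
  left-value {+ a} {+ b} (leftSupport (+≤+ _) (+≤+ _) (+≤+ _) R-cons W-cons (+≤+ j₂≤c) W*-cons (+≤+ j₁≤c)) =
    trans (mono-* (R-value (ℤ.+-injective R-cons)) (W-value (ℤ.+-injective W-cons) j₂≤c)
                  (W*-value (ℤ.+-injective W*-cons) j₁≤c))
          (cong₂ mono
            (trans (ℕ.+-identityʳ _) (trans (ℕ.+-comm (b ℕ.⊓ a) j₂) (cong (j₂ ℕ.+_) (ℕ.⊓-comm b a))))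
            (trans (cong (ℕ._+ j₁) (ℕ.+-identityʳ _)) (trans (ℕ.+-comm (b ℕ.⊓ a) j₁) (cong (j₁ ℕ.+_) (ℕ.⊓-comm b a)))))

  -- Conservation in `R` determines `k₂` and conservation in `W*` determines `k₃`; conservation in
  -- `W` then amounts to the balance condition.
  LeftSupport-line : ∀ {a b c} → LeftSupport a b c → b ≡ k₂ a × c ≡ k₃ a
  LeftSupport-line {a} {b} s = p+q≡r⇒p≡r-q (trans (ℤ.+-comm b (+ i₁)) (sym R-cons)) , p+q≡r⇒p≡r-q W*-cons
    where open LeftSupport s

  -- Nonnegativity of `k₁` and `k₂` gives the two lower bounds; `j₁ ≤ k₃` and `j₂ ≤ k₃` give the two
  -- upper bounds.
  LeftSupport⇒∈L : ∀ {k} → LeftSupport k (k₂ k) (k₃ k) → k ∈L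
  LeftSupport⇒∈L {k} s =
      ℤ.⊔-lub 0≤k₁ (≤-by-difference (lower (+ i₁) (+ i₂) k) 0≤k₂)
    , ℤ.⊓-glb (≤-by-difference (upper₁ (+ i₃) (+ j₁) k) j₁≤k₃)
              (≤-by-difference (upper₂ (+ i₃) (+ j₁) (+ j₂) k) j₂≤k₃)
    where
    open LeftSupport s
    lower : ∀ i₁ i₂ k → (i₂ + k - i₁) - 0ℤ ≡ k - (i₁ - i₂)
    lower = solve-∀
    upper₁ : ∀ i₃ j₁ k → (i₃ + j₁ - k) - j₁ ≡ i₃ - k
    upper₁ = solve-∀
    upper₂ : ∀ i₃ j₁ j₂ k → (i₃ + j₁ - k) - j₂ ≡ (i₃ + j₁ - j₂) - k
    upper₂ = solve-∀

  ∈L⇒LeftSupport : ∀ {k} → k ∈L → LeftSupport k (k₂ k) (k₃ k)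
  ∈L⇒LeftSupport {k} (lo , hi) = record
    { 0≤k₁    = ℤ.i⊔j≤k⇒i≤k _ _ lo
    ; 0≤k₂    = ≤-by-difference (lower (+ i₁) (+ i₂) k) (ℤ.i⊔j≤k⇒j≤k _ _ lo)
    ; 0≤k₃    = ℤ.≤-trans (+≤+ z≤n) j₁≤k₃
    ; R-cons  = R-cons (+ i₁) (+ i₂) k
    -- On the line, `k` cancels in `k₃ + k₂`, and the balance condition identifies the constant.
    ; W-cons  = trans (W-cons₁ (+ i₁) (+ i₂) (+ i₃) (+ j₁) (+ j₂) k)
               (trans (cong (_+ (+ j₂ + + i₂ - + i₁)) balance-shift)
                      (W-cons₂ (+ i₁) (+ i₂) (+ j₂) (+ j₃)))
    ; j₂≤k₃   = ≤-by-difference (upper₂ (+ i₃) (+ j₁) (+ j₂) k) (ℤ.i≤j⊓k⇒i≤k _ _ hi)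
    ; W*-cons = W*-cons (+ i₃) (+ j₁) k
    ; j₁≤k₃   = j₁≤k₃
    }
    where
    lower : ∀ i₁ i₂ k → k - (i₁ - i₂) ≡ (i₂ + k - i₁) - 0ℤ
    lower = solve-∀
    upper₁ : ∀ i₃ j₁ k → i₃ - k ≡ (i₃ + j₁ - k) - j₁
    upper₁ = solve-∀
    upper₂ : ∀ i₃ j₁ j₂ k → (i₃ + j₁ - j₂) - k ≡ (i₃ + j₁ - k) - j₂
    upper₂ = solve-∀
    R-cons : ∀ i₁ i₂ k → i₂ + k ≡ i₁ + (i₂ + k - i₁)
    R-cons = solve-∀
    W-cons₁ : ∀ i₁ i₂ i₃ j₁ j₂ k →
              (i₃ + j₁ - k) + (i₂ + k - i₁) ≡ (i₃ + (j₁ - j₂)) + (j₂ + i₂ - i₁)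
    W-cons₁ = solve-∀
    W-cons₂ : ∀ i₁ i₂ j₂ j₃ → (j₃ + (i₁ - i₂)) + (j₂ + i₂ - i₁) ≡ j₃ + j₂
    W-cons₂ = solve-∀
    W*-cons : ∀ i₃ j₁ k → (i₃ + j₁ - k) + k ≡ i₃ + j₁
    W*-cons = solve-∀
    j₁≤k₃ : + j₁ ≤ k₃ k
    j₁≤k₃ = ≤-by-difference (upper₁ (+ i₃) (+ j₁) k) (ℤ.i≤j⊓k⇒i≤j _ _ hi)

  -- Support and value of the right-hand terms

  record RightSupport (k₁′ k₂′ k₃′ : ℤ) : Set where
    constructor rightSupport
    field
      0≤k₁′   : 0ℤ ≤ k₁′
      0≤k₂′   : 0ℤ ≤ k₂′
      0≤k₃′   : 0ℤ ≤ k₃′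
      W-cons  : + i₃ + + i₂ ≡ k₃′ + k₂′
      k₂′≤i₃  : k₂′ ≤ + i₃
      W*-cons : + j₃ + + i₁ ≡ k₃′ + k₁′
      k₁′≤j₃  : k₁′ ≤ + j₃
      R-cons  : k₂′ + + j₁ ≡ k₁′ + + j₂

  right≢0⇒support : ∀ a b c → right a b c ≢ 0# → RightSupport a b c
  right≢0⇒support a b c right≢0 = support
    (extend≢0⇒lifted (W x) (+ i₃) (+ i₂) c b (*-≢0ˡ W*ₑ WW*≢0))
    (extend≢0⇒lifted (W* y) c (+ i₁) (+ j₃) a (*-≢0ʳ Wₑ WW*≢0))
    (extend≢0⇒lifted (R x y) b a (+ j₂) (+ j₁) (*-≢0ʳ (Wₑ * W*ₑ) right≢0))
    where
    Wₑ  = extend (W x) (+ i₃) (+ i₂) c b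
    W*ₑ = extend (W* y) c (+ i₁) (+ j₃) a
    WW*≢0 = *-≢0ˡ (extend (R x y) b a (+ j₂) (+ j₁)) right≢0
    support : ∀ {a b c} → Lifted (W x) (+ i₃) (+ i₂) c b → Lifted (W* y) c (+ i₁) (+ j₃) a →
              Lifted (R x y) b a (+ j₂) (+ j₁) → RightSupport a b c
    support (lifted w) (lifted w*) (lifted {i₁ = b} {j₁ = a} r) =
      let W-cons  , k₂′≤i₃ = W≢0 x w
          W*-cons , k₁′≤j₃ = W*≢0 y w*
      in rightSupport (+≤+ z≤n) (+≤+ z≤n) (+≤+ z≤n) (cong +_ W-cons) (+≤+ k₂′≤i₃)
           (cong +_ W*-cons) (+≤+ k₁′≤j₃) (cong +_ (R≢0 {b} {a} {j₂} {j₁} x y r))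

  right-value : ∀ {a b c} → RightSupport a b c →
                right a b c ≡ mono (∣ b ∣ ℕ.+ j₁ ℕ.⊓ j₂) (∣ a ∣ ℕ.+ j₁ ℕ.⊓ j₂)
  right-value {+ a} {+ b} (rightSupport (+≤+ _) (+≤+ _) (+≤+ _) W-cons (+≤+ b≤i₃) W*-cons (+≤+ a≤j₃) R-cons) =
    trans (mono-* (W-value (ℤ.+-injective W-cons) b≤i₃) (W*-value (ℤ.+-injective W*-cons) a≤j₃)
                  (R-value (ℤ.+-injective R-cons)))
          (cong₂ mono (cong₂ ℕ._+_ (ℕ.+-identityʳ b) (ℕ.⊓-comm j₂ j₁))
                      (cong (a ℕ.+_) (ℕ.⊓-comm j₂ j₁)))

  RightSupport-line : ∀ {a b c} → RightSupport a b c → b ≡ k₂′ a × c ≡ k₃′ a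
  RightSupport-line s = p+q≡r⇒p≡r-q R-cons , p+q≡r⇒p≡r-q (sym W*-cons)
    where open RightSupport s

  -- `W` bounds `k₂′` by `i₃`, whereas the right interval is written with `j₃`; the balance
  -- condition passes from one to the other.
  i₃-k₂′≡j₃+i₁-i₂-k₁′ : ∀ k → + i₃ - k₂′ k ≡ (+ j₃ + + i₁ - + i₂) - k
  i₃-k₂′≡j₃+i₁-i₂-k₁′ k = trans (expand (+ i₃) (+ j₁) (+ j₂) k)
                         (trans (cong (_- k) balance-shift) (collect (+ i₁) (+ i₂) (+ j₃) k))
    where
    expand : ∀ i₃ j₁ j₂ k → i₃ - (k + j₂ - j₁) ≡ (i₃ + (j₁ - j₂)) - k
    expand = solve-∀
    collect : ∀ i₁ i₂ j₃ k → (j₃ + (i₁ - i₂)) - k ≡ (j₃ + i₁ - i₂) - k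
    collect = solve-∀

  RightSupport⇒∈R : ∀ {k} → RightSupport k (k₂′ k) (k₃′ k) → k ∈R
  RightSupport⇒∈R {k} s =
      ℤ.⊔-lub 0≤k₁′ (≤-by-difference (lower (+ j₁) (+ j₂) k) 0≤k₂′)
    , ℤ.⊓-glb k₁′≤j₃ (≤-by-difference (i₃-k₂′≡j₃+i₁-i₂-k₁′ k) k₂′≤i₃)
    where
    open RightSupport s
    lower : ∀ j₁ j₂ k → (k + j₂ - j₁) - 0ℤ ≡ k - (j₁ - j₂)
    lower = solve-∀

  ∈R⇒RightSupport : ∀ {k} → k ∈R → RightSupport k (k₂′ k) (k₃′ k)
  ∈R⇒RightSupport {k} (lo , hi) = record
    { 0≤k₁′   = ℤ.i⊔j≤k⇒i≤k _ _ lo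
    ; 0≤k₂′   = ≤-by-difference (lower (+ j₁) (+ j₂) k) (ℤ.i⊔j≤k⇒j≤k _ _ lo)
    -- In fact `i₁ ≤ k₃′`, because `k₃′ - i₁` is `j₃ - k`.
    ; 0≤k₃′   = ℤ.≤-trans (+≤+ z≤n) (≤-by-difference (upper (+ i₁) (+ j₃) k) k≤j₃)
    ; W-cons  = sym (trans (W-cons₁ (+ i₁) (+ i₂) (+ j₁) (+ j₂) (+ j₃) k)
               (trans (cong (_+ (+ i₂ + + j₂ - + j₁)) (sym balance-shift))
                      (W-cons₂ (+ i₂) (+ i₃) (+ j₁) (+ j₂))))
    ; k₂′≤i₃  = ≤-by-difference (sym (i₃-k₂′≡j₃+i₁-i₂-k₁′ k)) (ℤ.i≤j⊓k⇒i≤k _ _ hi)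
    ; W*-cons = W*-cons (+ i₁) (+ j₃) k
    ; k₁′≤j₃  = k≤j₃
    ; R-cons  = R-cons (+ j₁) (+ j₂) k
    }
    where
    k≤j₃ : k ≤ + j₃
    k≤j₃ = ℤ.i≤j⊓k⇒i≤j _ _ hi
    lower : ∀ j₁ j₂ k → k - (j₁ - j₂) ≡ (k + j₂ - j₁) - 0ℤ
    lower = solve-∀
    upper : ∀ i₁ j₃ k → j₃ - k ≡ (j₃ + i₁ - k) - i₁
    upper = solve-∀
    W-cons₁ : ∀ i₁ i₂ j₁ j₂ j₃ k →
              (j₃ + i₁ - k) + (k + j₂ - j₁) ≡ (j₃ + (i₁ - i₂)) + (i₂ + j₂ - j₁)
    W-cons₁ = solve-∀
    W-cons₂ : ∀ i₂ i₃ j₁ j₂ → (i₃ + (j₁ - j₂)) + (i₂ + j₂ - j₁) ≡ i₃ + i₂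
    W-cons₂ = solve-∀
    W*-cons : ∀ i₁ j₃ k → j₃ + i₁ ≡ (j₃ + i₁ - k) + k
    W*-cons = solve-∀
    R-cons : ∀ j₁ j₂ k → (k + j₂ - j₁) + j₁ ≡ k + j₂
    R-cons = solve-∀

  -- Summands on the free line in normal form

  leftSummand≢0⇒∈L : ∀ k → leftSummand k ≢ 0# → k ∈L
  leftSummand≢0⇒∈L k = LeftSupport⇒∈L ∘ left≢0⇒support k (k₂ k) (k₃ k)

  rightSummand≢0⇒∈R : ∀ k → rightSummand k ≢ 0# → k ∈R
  rightSummand≢0⇒∈R k = RightSupport⇒∈R ∘ right≢0⇒support k (k₂′ k) (k₃′ k)

  leftSummand-value : ∀ {k} → k ∈L →
    leftSummand k ≡ mono (j₂ ℕ.+ ∣ k ⊓ k₂ k ∣) (j₁ ℕ.+ ∣ k ⊓ k₂ k ∣)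
  leftSummand-value k∈L = left-value (∈L⇒LeftSupport k∈L)

  rightSummand-value : ∀ {k} → k ∈R →
    rightSummand k ≡ mono (∣ k₂′ k ∣ ℕ.+ j₁ ℕ.⊓ j₂) (∣ k ∣ ℕ.+ j₁ ℕ.⊓ j₂)
  rightSummand-value k∈R = right-value (∈R⇒RightSupport k∈R)

  leftMonomial-value : ∀ k → leftMonomial k ≡ mono (j₂ ℕ.+ ∣ k ⊓ k₂ k ∣) (j₁ ℕ.+ ∣ k ⊓ k₂ k ∣)
  leftMonomial-value k =
    trans (mono-* (x^n≡mono j₂) (y^n≡mono j₁) ([xy]^n≡mono ∣ k ⊓ k₂ k ∣))
          (cong (λ m → mono (m ℕ.+ ∣ k ⊓ k₂ k ∣) (j₁ ℕ.+ ∣ k ⊓ k₂ k ∣)) (ℕ.+-identityʳ j₂))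

  rightMonomial-value : ∀ k → rightMonomial k ≡ mono (∣ k₂′ k ∣ ℕ.+ j₁ ℕ.⊓ j₂) (∣ k ∣ ℕ.+ j₁ ℕ.⊓ j₂)
  rightMonomial-value k =
    trans (mono-* (x^n≡mono ∣ k₂′ k ∣) (y^n≡mono ∣ k ∣) ([xy]^n≡mono (j₁ ℕ.⊓ j₂)))
          (cong (λ m → mono (m ℕ.+ j₁ ℕ.⊓ j₂) (∣ k ∣ ℕ.+ j₁ ℕ.⊓ j₂)) (ℕ.+-identityʳ ∣ k₂′ k ∣))

  -- The translation between the two intervals

  k⊓k₂ : ∀ k → k ⊓ k₂ k ≡ k - (0ℤ ⊔ (+ i₁ - + i₂))
  -- Since `k` is `k₂ k` shifted by `i₁ - i₂`, `⊓-+` applies. The minimum is thus the distance from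
  -- `k` to the lower end of the left interval.
  k⊓k₂ k = trans (ℤ.⊓-comm k (k₂ k))
          (trans (cong (k₂ k ⊓_) (k≡k₂+shift (+ i₁) (+ i₂) k))
          (trans (⊓-+ (k₂ k) (+ i₁ - + i₂))
                 (cong (_- (0ℤ ⊔ (+ i₁ - + i₂))) (sym (k≡k₂+shift (+ i₁) (+ i₂) k)))))
    where
    k≡k₂+shift : ∀ i₁ i₂ k → k ≡ (i₂ + k - i₁) + (i₁ - i₂)
    k≡k₂+shift = solve-∀

  -- `j₁ - (j₁ ⊓ j₂)` is the lower end of the right interval, and `k ⊓ k₂ k` is the distance of `k`
  -- from the left one.
  φ≡φ-alt : ∀ k → φ k ≡ φ-alt k
  φ≡φ-alt k = trans (cong₂ (λ m n → + j₁ - m + n) j₁⊓j₂ (k⊓k₂ k))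
                    (cancel (+ j₁) k (0ℤ ⊔ (+ j₁ - + j₂)) (0ℤ ⊔ (+ i₁ - + i₂)))
    where
    j₁≡j₂+shift : ∀ j₁ j₂ → j₁ ≡ j₂ + (j₁ - j₂)
    j₁≡j₂+shift = solve-∀
    j₁⊓j₂ : + j₁ ⊓ + j₂ ≡ + j₁ - (0ℤ ⊔ (+ j₁ - + j₂))
    j₁⊓j₂ = trans (ℤ.⊓-comm (+ j₁) (+ j₂))
           (trans (cong (+ j₂ ⊓_) (j₁≡j₂+shift (+ j₁) (+ j₂)))
           (trans (⊓-+ (+ j₂) (+ j₁ - + j₂))
                  (cong (_- (0ℤ ⊔ (+ j₁ - + j₂))) (sym (j₁≡j₂+shift (+ j₁) (+ j₂))))))
    cancel : ∀ j k u v → j - (j - u) + (k - v) ≡ k + u - v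
    cancel = solve-∀

  -- By `⊓-+` each upper end is the common value from `balance-shift` minus a maximum; both lengths
  -- subtract the same two maxima, in opposite order.
  equal-lengths : (+ i₃ ⊓ (+ i₃ + + j₁ - + j₂)) - (0ℤ ⊔ (+ i₁ - + i₂))
                ≡ (+ j₃ ⊓ (+ j₃ + + i₁ - + i₂)) - (0ℤ ⊔ (+ j₁ - + j₂))
  equal-lengths =
    trans (cong (_- (0ℤ ⊔ (+ i₁ - + i₂))) (upper (+ i₃) (+ j₁) (+ j₂)))
   (trans (cong (λ s → s - (0ℤ ⊔ (+ j₁ - + j₂)) - (0ℤ ⊔ (+ i₁ - + i₂))) balance-shift)
   (trans (swap (+ j₃ + (+ i₁ - + i₂)) (0ℤ ⊔ (+ j₁ - + j₂)) (0ℤ ⊔ (+ i₁ - + i₂)))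
          (cong (_- (0ℤ ⊔ (+ j₁ - + j₂))) (sym (upper (+ j₃) (+ i₁) (+ i₂))))))
    where
    upper : ∀ p a b → p ⊓ (p + a - b) ≡ p + (a - b) - (0ℤ ⊔ (a - b))
    upper p a b = trans (cong (p ⊓_) (ℤ.+-assoc p a (ℤ.- b))) (⊓-+ p (a - b))
    swap : ∀ s u v → s - u - v ≡ s - v - u
    swap = solve-∀

  φ-↔ : LeftInterval ↔ RightInterval
  φ-↔ = translate equal-lengths

  φ-∈R : ∀ {k} → k ∈L → φ k ∈R
  φ-∈R {k} k∈L = subst _∈R (sym (φ≡φ-alt k)) (translate-∈ equal-lengths k∈L)

  0≤k⊓k₂ : ∀ {k} → k ∈L → 0ℤ ≤ k ⊓ k₂ k
  0≤k⊓k₂ k∈L = ℤ.⊓-glb 0≤k₁ 0≤k₂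
    where open LeftSupport (∈L⇒LeftSupport k∈L)

  -- By its defining formula, `φ k + (j₁ ⊓ j₂) = j₁ + (k ⊓ k₂ k)`, which equates the exponents of
  -- `y`; adding `j₂ - j₁` equates those of `x`.
  summand-φ : ∀ {k} → k ∈L → leftSummand k ≡ rightSummand (φ k)
  summand-φ {k} k∈L =
    trans (leftSummand-value k∈L)
   (trans (cong₂ mono (exponent 0≤k₂′ (0≤k⊓k₂ k∈L) (exponent-x (+ j₁) (+ j₂) (+ j₁ ⊓ + j₂) (k ⊓ k₂ k)))
                      (exponent 0≤k₁′ (0≤k⊓k₂ k∈L) (exponent-y (+ j₁) (+ j₁ ⊓ + j₂) (k ⊓ k₂ k))))
          (sym (rightSummand-value (φ-∈R k∈L))))
    where
    open RightSupport (∈R⇒RightSupport (φ-∈R k∈L))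
    exponent : ∀ {p q m n} → 0ℤ ≤ p → 0ℤ ≤ q → + n + q ≡ p + + m → n ℕ.+ ∣ q ∣ ≡ ∣ p ∣ ℕ.+ m
    exponent (+≤+ _) (+≤+ _) = ℤ.+-injective
    exponent-x : ∀ j₁ j₂ m M → j₂ + M ≡ (j₁ - m + M + j₂ - j₁) + m
    exponent-x = solve-∀
    exponent-y : ∀ j₁ m M → j₁ + M ≡ (j₁ - m + M) + m
    exponent-y = solve-∀

  -- Distinctness of the monomials on each side

  ∣∣-injective-nonNeg : ∀ {p q} → 0ℤ ≤ p → 0ℤ ≤ q → ∣ p ∣ ≡ ∣ q ∣ → p ≡ q
  ∣∣-injective-nonNeg (+≤+ _) (+≤+ _) e = cong +_ e

  -- The exponent of `y` is `j₁` plus the minimum, which by `k⊓k₂` differs from `k` by a constant.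
  leftSummand-injective : ∀ {k l} → k ∈L → l ∈L → leftSummand k ≈ leftSummand l → k ≡ l
  leftSummand-injective {k} {l} k∈L l∈L e = ∙-cancelʳ _ k l
    (trans (sym (k⊓k₂ k)) (trans minima (k⊓k₂ l)))
    where
    open import Algebra.Properties.AbelianGroup ℤ.+-0-abelianGroup using (∙-cancelʳ)
    minima : k ⊓ k₂ k ≡ l ⊓ k₂ l
    minima = ∣∣-injective-nonNeg (0≤k⊓k₂ k∈L) (0≤k⊓k₂ l∈L) (ℕ.+-cancelˡ-≡ j₁ _ _
      (proj₂ (mono-injective (subst₂ _≈_ (leftSummand-value k∈L) (leftSummand-value l∈L) e))))

  rightSummand-injective : ∀ {k l} → k ∈R → l ∈R → rightSummand k ≈ rightSummand l → k ≡ l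
  rightSummand-injective k∈R l∈R e =
    ∣∣-injective-nonNeg (0≤k₁′ (∈R⇒RightSupport k∈R)) (0≤k₁′ (∈R⇒RightSupport l∈R)) (ℕ.+-cancelʳ-≡ (j₁ ℕ.⊓ j₂) _ _
      (proj₂ (mono-injective (subst₂ _≈_ (rightSummand-value k∈R) (rightSummand-value l∈R) e))))
    where open RightSupport

-- Support, bijection and uniqueness combined

open import Data.Nat.Base using (_+_)

lemma3p2 : (i₁ i₂ i₃ j₁ j₂ j₃ : ℕ) →
    i₁ + j₂ + j₃ ≡ i₂ + i₃ + j₁ →
    let open YangBaxter i₁ i₂ i₃ j₁ j₂ j₃ in
    ( (∀ a b c → left a b c ≉ 0# → b ≡ k₂ a × c ≡ k₃ a)
    × (∀ a b c → right a b c ≉ 0# → b ≡ k₂′ a × c ≡ k₃′ a) )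
    ×
    ( (∀ k → k ∈L → leftSummand k ≈ leftMonomial k)
    × (∀ k → ¬ (k ∈L) → leftSummand k ≈ 0#)
    × (∀ k → leftSummand k ≉ 0# ⇔ k ∈L)
    × (∀ k → k ∈R → rightSummand k ≈ rightMonomial k)
    × (∀ k → ¬ (k ∈R) → rightSummand k ≈ 0#)
    × (∀ k → rightSummand k ≉ 0# ⇔ k ∈R)
    × (∃[ n ] ((LeftInterval ⤖ Fin n) × (RightInterval ⤖ Fin n))) )
    ×
    ( (∀ k → k ∈L → φ k ≡ φ-alt k)
    × (Σ[ f ∈ LeftInterval ⤖ RightInterval ]
    ((∀ k → proj₁ (Bijection.to f k) ≡ φ (proj₁ k))
    × WeightPreserving (Bijection.to f))) )
    ×
    ( (∀ (g : LeftInterval ⤖ RightInterval) → WeightPreserving (Bijection.to g) →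
    ∀ k → proj₁ (Bijection.to g k) ≡ φ (proj₁ k))
    × (∀ k l → k ∈L → l ∈L → leftSummand k ≈ leftSummand l → k ≡ l)
    × (∀ k l → k ∈R → l ∈R → rightSummand k ≈ rightSummand l → k ≡ l) )
lemma3p2 i₁ i₂ i₃ j₁ j₂ j₃ balance =
    ( (λ a b c → LeftSupport-line ∘ left≢0⇒support a b c ∘ ≉0⇒≢0)
    , (λ a b c → RightSupport-line ∘ right≢0⇒support a b c ∘ ≉0⇒≢0) )
  , ( (λ k k∈L → ≈-reflexive (trans (leftSummand-value k∈L) (sym (leftMonomial-value k))))
    , (λ k k∉L → ¬≢0⇒≈0 (k∉L ∘ leftSummand≢0⇒∈L k))
    , (λ k → mk⇔ (leftSummand≢0⇒∈L k ∘ ≉0⇒≢0)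
                 (λ k∈L → subst (_≉ 0#) (sym (leftSummand-value k∈L)) (mono≉0 _ _)))
    , (λ k k∈R → ≈-reflexive (trans (rightSummand-value k∈R) (sym (rightMonomial-value k))))
    , (λ k k∉R → ¬≢0⇒≈0 (k∉R ∘ rightSummand≢0⇒∈R k))
    , (λ k → mk⇔ (rightSummand≢0⇒∈R k ∘ ≉0⇒≢0)
                 (λ k∈R → subst (_≉ 0#) (sym (rightSummand-value k∈R)) (mono≉0 _ _)))
    , (let n , e = Interval↔Fin _ _ in n , ↔⇒⤖ e , ↔⇒⤖ (e ↔-∘ ↔-sym φ-↔)) )
  , ( (λ k _ → φ≡φ-alt k)
    , ↔⇒⤖ φ-↔
    -- The map underlying `φ-↔` is `φ-alt` by definition.
    , (λ (k , _) → sym (φ≡φ-alt k))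
    , (λ (k , k∈L) → ≈-reflexive (trans (summand-φ k∈L) (cong rightSummand (φ≡φ-alt k)))) )
  -- The right summands at the image under `g` and at `φ k` both equal the left summand at `k`, so
  -- the two indices agree.
  , ( (λ g g-preserves k → rightSummand-injective (proj₂ (Bijection.to g k)) (φ-∈R (proj₂ k))
        (≈-trans (≈-sym (g-preserves k)) (≈-reflexive (summand-φ (proj₂ k)))))
    , (λ k l → leftSummand-injective)
    , (λ k l → rightSummand-injective) )
  where
  open YangBaxter i₁ i₂ i₃ j₁ j₂ j₃
  open Summands i₁ i₂ i₃ j₁ j₂ j₃ balance
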